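{- Let $P$ be a finite near-simplicial poset of rank $d$ with $f$-vector $(f_{ -1},f_0,\dots,f_d)$. Then $$\mathcal{M}_P(z)=g^P_d(z)+\sum_{r=-1}^{d-1}(1-z)^{r+1}f_r.$$
   Context: A ranked poset is a poset with a rank function $|\cdot|$ such that covering relations increase rank by one and minimal elements have rank $-1$; $f_r$ is the number of elements of rank $r$; $P_{\le i}=\{p:|p|\le i\}$. A simplicial poset is a ranked poset in which every closed interval $[p,q]$ ($p\le q$) is isomorphic to a Boolean lattice (the subsets of $\{1,\dots,n\}$ under inclusion) for some $n$. A near-simplicial poset of rank $d$ is a ranked poset $P$ such that $P_{\le d-1}$ is a disjoint union (elements of different components incomparable) of simplicial posets each having a unique minimum element. The Möbius function $\mu$ is $\mu[p,p]=1$, $\mu[p,q]=-\sum_{p\le s<q}\mu[p,s]$ for $p<q$, $0$ if $p\not\le q$; $\mu_z[p,q]=\mu[p,q]z^{|q|-|p|}$; $\mathcal{M}_P(z)=\sum_{p\le q\in P}\mu_z[p,q]$; $g^P_d(z)=\sum_{p\le q,\ |p|\le d\le |q|}\mu_z[p,q]$. -}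

module Defs where

open import Level using (Level; _⊔_; 0ℓ) renaming (suc to lsuc)
open import Algebra.Bundles using (RawMonoid; RawRing)
import Algebra.Definitions.RawSemiring as RawSemiringDefs
open import Data.Fin using (Fin)
open import Data.Fin.Induction using (po-wellFounded)
open import Data.Fin.Subset.Properties using (⊆-poset)
open import Data.Integer as ℤ using (ℤ; +_; 0ℤ; 1ℤ; -1ℤ; ∣_∣)
open import Data.List using (List; []; _∷_; map; foldr; filter; length; upTo; tabulate; cartesianProduct)
open import Data.Nat using (ℕ; zero; suc)
open import Data.Product using (Σ; ∃; _×_; _,_; proj₁; proj₂)
open import Function using (Inverse)
open import Induction.WellFounded using (Acc; acc; WellFounded)
open import Relation.Binary using (Poset; DecPoset; Minimum)
import Relation.Binary.Construct.On as On
import Relation.Binary.Construct.NonStrictToStrict as ToStrict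
open import Relation.Binary.Morphism.Structures using (IsOrderIsomorphism)
open import Relation.Binary.PropositionalEquality using (_≡_; setoid)
open import Relation.Nullary using (¬_; Dec; yes; no)
open import Relation.Nullary.Decidable using (_×-dec_)

private
  variable
    a c ℓ ℓ₁ ℓ₂ c′ ℓ₁′ ℓ₂′ : Level

∑ : (M : RawMonoid c ℓ) {A : Set a} → List A → (A → RawMonoid.Carrier M) → RawMonoid.Carrier M
∑ M xs h = foldr (RawMonoid._∙_ M) (RawMonoid.ε M) (map h xs)

------------------------------------------------------------------------
-- ℤ[z]: coefficient lists, constant term first.  Trailing zeros are
-- allowed, so equality is equality of all coefficients.

module Polynomial where

  Poly : Set
  Poly = List ℤ

  coeff : Poly → ℕ → ℤ
  coeff []      k       = 0ℤ
  coeff (x ∷ p) zero    = x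
  coeff (x ∷ p) (suc k) = coeff p k

  infix 4 _≈_
  _≈_ : Poly → Poly → Set
  p ≈ q = ∀ k → coeff p k ≡ coeff q k

  infixl 6 _+_
  _+_ : Poly → Poly → Poly
  []      + q       = q
  (x ∷ p) + []      = x ∷ p
  (x ∷ p) + (y ∷ q) = (x ℤ.+ y) ∷ (p + q)

  infixl 7 _*_
  _*_ : Poly → Poly → Poly
  []      * q = []
  (x ∷ p) * q = map (x ℤ.*_) q + (0ℤ ∷ p * q)

  const : ℤ → Poly
  const x = x ∷ []

  z : Poly
  z = 0ℤ ∷ 1ℤ ∷ []

  ℤ[z] : RawRing 0ℓ 0ℓ
  ℤ[z] = record
    { Carrier = Poly
    ; _≈_     = _≈_
    ; _+_     = _+_
    ; _*_     = _*_
    ; -_      = map (λ x → ℤ.- x)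
    ; 0#      = []
    ; 1#      = const 1ℤ
    }

  open RawRing ℤ[z] public using (-_; 1#; rawSemiring; +-rawMonoid)
  open RawSemiringDefs rawSemiring public using (_^_)

------------------------------------------------------------------------
-- Ranked, simplicial and near-simplicial posets

subposet : (P : Poset c ℓ₁ ℓ₂) → (Poset.Carrier P → Set ℓ) → Poset (c ⊔ ℓ) ℓ₁ ℓ₂
subposet P Q = On.poset P (proj₁ {B = Q})

_≅_ : Poset c ℓ₁ ℓ₂ → Poset c′ ℓ₁′ ℓ₂′ → Set (c ⊔ ℓ₁ ⊔ ℓ₂ ⊔ c′ ⊔ ℓ₁′ ⊔ ℓ₂′)
P ≅ Q = ∃ (IsOrderIsomorphism P._≈_ Q._≈_ P._≤_ Q._≤_)
  where
  module P = Poset P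
  module Q = Poset Q

module _ (P : Poset c ℓ₁ ℓ₂) where

  open Poset P renaming (Carrier to A)
  open ToStrict _≈_ _≤_ using (_<_)

  _⋖_ : A → A → Set (c ⊔ ℓ₁ ⊔ ℓ₂)
  p ⋖ q = p < q × ¬ (∃ λ s → p < s × s < q)

  Minimal : A → Set (c ⊔ ℓ₁ ⊔ ℓ₂)
  Minimal p = ∀ q → q ≤ p → q ≈ p

  interval : A → A → Poset (c ⊔ ℓ₂) ℓ₁ ℓ₂
  interval p q = subposet P (λ s → p ≤ s × s ≤ q)

  record IsRanked (rank : A → ℤ) : Set (c ⊔ ℓ₁ ⊔ ℓ₂) where
    field
      rank-cong    : ∀ {p q} → p ≈ q → rank p ≡ rank q
      rank-cover   : ∀ {p q} → p ⋖ q → rank q ≡ rank p ℤ.+ 1ℤ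
      rank-minimal : ∀ {p} → Minimal p → rank p ≡ -1ℤ

  record IsSimplicial (rank : A → ℤ) : Set (c ⊔ ℓ₁ ⊔ ℓ₂) where
    field
      isRanked         : IsRanked rank
      interval-boolean : ∀ p q → p ≤ q → ∃ λ n → interval p q ≅ ⊆-poset n

  record HasRank (rank : A → ℤ) (d : ℤ) : Set c where
    field
      bounded  : ∀ p → rank p ℤ.≤ d
      attained : ∃ λ p → rank p ≡ d

  below : (A → ℤ) → ℤ → Poset c ℓ₁ ℓ₂
  below rank i = subposet P (λ p → rank p ℤ.≤ i)

-- A decomposition of P as a disjoint union of k simplicial posets, each
-- with a minimum (necessarily unique, by antisymmetry), is given by the
-- map sending an element to the part containing it.

record IsDisjointUnionOfPointedSimplicial
         (P : Poset c ℓ₁ ℓ₂) (rank : Poset.Carrier P → ℤ) : Set (c ⊔ ℓ₁ ⊔ ℓ₂) where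
  open Poset P using (_≤_) renaming (Carrier to A)
  field
    k         : ℕ
    component : A → Fin k

  part : Fin k → Poset c ℓ₁ ℓ₂
  part i = subposet P (λ p → component p ≡ i)

  field
    incomparable : ∀ {p q} → p ≤ q → component p ≡ component q
    simplicial   : ∀ i → IsSimplicial (part i) (λ p → rank (proj₁ p))
    minimum      : ∀ i → ∃ (Minimum (Poset._≤_ (part i)))

record IsNearSimplicial
         (P : Poset c ℓ₁ ℓ₂) (rank : Poset.Carrier P → ℤ) (d : ℤ) : Set (c ⊔ ℓ₁ ⊔ ℓ₂) where
  field
    isRanked : IsRanked P rank
    hasRank  : HasRank P rank d
    lower    : IsDisjointUnionOfPointedSimplicial
                 (below P rank (d ℤ.- 1ℤ)) (λ p → rank (proj₁ p))

------------------------------------------------------------------------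
-- Finite posets

record FinitePoset c ℓ₁ ℓ₂ : Set (lsuc (c ⊔ ℓ₁ ⊔ ℓ₂)) where
  field
    decPoset : DecPoset c ℓ₁ ℓ₂

  open DecPoset decPoset public renaming (Carrier to A)

  field
    size        : ℕ
    enumeration : Inverse Eq.setoid (setoid (Fin size))

  open Inverse enumeration public using (to; from; strictlyInverseʳ)
  open ToStrict _≈_ _≤_ public using (_<_; <-decidable; <-resp-≈)

  elements : List A
  elements = tabulate from

  _<?_ : ∀ p q → Dec (p < q)
  _<?_ = <-decidable _≟_ _≤?_

  <-wellFounded : WellFounded _<_
  <-wellFounded q = go (po-wellFounded (On.isPartialOrder from isPartialOrder) (to q))
    where
    _⊏_ : Fin size → Fin size → Set (ℓ₁ ⊔ ℓ₂)
    i ⊏ j = from i < from j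

    transport : ∀ {p q} → p < q → to p ⊏ to q
    transport {p} {q} p<q =
      proj₁ resp (Eq.sym (strictlyInverseʳ q)) (proj₂ resp (Eq.sym (strictlyInverseʳ p)) p<q)
      where resp = <-resp-≈ (DecPoset.Eq.isEquivalence decPoset) ≤-resp-≈

    go : ∀ {q} → Acc _⊏_ (to q) → Acc _<_ q
    go (acc rs) = acc λ p<q → go (rs (transport p<q))

whenYes : {B : Set ℓ} → Dec B → (B → ℤ) → ℤ
whenYes (yes b) h = h b
whenYes (no  _) h = 0ℤ

module _ (P : FinitePoset c ℓ₁ ℓ₂) where

  open FinitePoset P

  -- Recursion on q along _<_; in the last clause the summand is 0
  -- unless p ≤ s < q.
  möbius-acc : (p q : A) → Acc _<_ q → ℤ
  möbius-acc p q (acc rs) with p ≤? q | p ≟ q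
  ... | no  _ | _     = 0ℤ
  ... | yes _ | yes _ = 1ℤ
  ... | yes _ | no  _ =
    ℤ.- ∑ ℤ.+-0-rawMonoid elements λ s →
          whenYes (p ≤? s ×-dec s <? q) λ (_ , s<q) → möbius-acc p s (rs s<q)

  μ : A → A → ℤ
  μ p q = möbius-acc p q (<-wellFounded q)

module _ (P : FinitePoset c ℓ₁ ℓ₂) (rank : FinitePoset.A P → ℤ) where

  open FinitePoset P using (A; elements; _≤?_)
  open Polynomial

  f : ℤ → ℕ
  f r = length (filter (λ p → rank p ℤ.≟ r) elements)

  -- Only used for p ≤ q, where |q| - |p| is nonnegative.
  μ[z] : A × A → Poly
  μ[z] (p , q) = const (μ P p q) * z ^ ∣ rank q ℤ.- rank p ∣

  𝓜 : Poly
  𝓜 = ∑ +-rawMonoid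
        (filter (λ (p , q) → p ≤? q) (cartesianProduct elements elements))
        μ[z]

  g : ℤ → Poly
  g d = ∑ +-rawMonoid
          (filter (λ (p , q) → p ≤? q ×-dec (rank p ℤ.≤? d ×-dec d ℤ.≤? rank q))
                  (cartesianProduct elements elements))
          μ[z]

-- The integers -1, 0, …, d - 1, for d ≥ -1.
ranksBelow : ℤ → List ℤ
ranksBelow d = map (λ i → + i ℤ.- 1ℤ) (upTo ∣ d ℤ.+ 1ℤ ∣)

{-# OPTIONS --safe #-}

-- All elements have rank at most d, so a pair p ≤ q is not counted by g exactly when |q| ≤ d - 1.
-- For such a q, let m be the minimum of its component.  The interval [m, q] is Boolean of
-- dimension n = |q| + 1 and μ[p, q] = (-1)^(|q| - |p|) for every p in it.  Hence
-- Σ_{p ≤ q} μ_z[p, q] = Σ_{S ⊆ [n]} (-z)^(n - |S|) = (1 - z)^(|q| + 1), and summing over q by rank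
-- gives the claim.  Everything is compared coefficient by coefficient, as sums of integers.
module Submission where

open import Defs
open import Level using (Level; _⊔_)
open import Algebra.Bundles using (AbelianGroup)
import Algebra.Properties.Group as GroupProperties
open import Data.Empty using (⊥-elim)
open import Data.Fin using (Fin)
open import Data.Fin.Subset using (Subset; inside; outside; _∈_; _⊆_; ∁; ⊤; ⊥) renaming (∣_∣ to card)
open import Data.Fin.Subset.Properties
  using (⊆-antisym; ⊆⊤; ⊥⊆; ∣⊤∣≡n; ∣∁p∣≡n∸∣p∣; ∣p∣≤n; s⊆s; drop-∷-⊆)
open import Data.Integer as ℤ using (ℤ; +_; 0ℤ; 1ℤ; -1ℤ; ∣_∣)
import Data.Integer.Properties as ℤₚ
open import Data.Integer.Tactic.RingSolver using (solve-∀)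
open import Data.List as List using (List; []; _∷_; _++_; map; filter; length; upTo; cartesianProduct)
open import Data.List.Membership.Propositional using () renaming (_∈_ to _∈ᴸ_)
open import Data.List.Membership.Propositional.Properties
  using (∈-map⁺; ∈-map⁻; ∈-++⁺ˡ; ∈-++⁺ʳ; ∈-tabulate⁺; ∈-allFin; ∈-upTo⁺; ∈-upTo⁻)
open import Data.List.Properties using (map-tabulate)
open import Data.List.Relation.Unary.All as All using (All)
open import Data.List.Relation.Unary.Any using (here; there)
open import Data.List.Relation.Unary.AllPairs using ([]; _∷_)
open import Data.List.Relation.Unary.Unique.Propositional using (Unique)
import Data.List.Relation.Unary.Unique.Propositional.Properties as Unique
open import Data.Nat as ℕ using (ℕ; zero; suc)
import Data.Nat.Properties as ℕₚ
open import Data.Product using (∃; _×_; _,_; proj₁; proj₂)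
open import Data.Vec using ([]; _∷_; here; there)
open import Data.Vec.Properties using (∷-injectiveʳ)
open import Function using (_∘_; id; Inverse)
open import Induction.WellFounded using (Acc; acc)
open import Relation.Binary using (DecPoset)
import Relation.Binary.Construct.NonStrictToStrict as ToStrict
open import Relation.Binary.Morphism.Structures using (IsOrderIsomorphism)
open import Relation.Binary.PropositionalEquality
  using (_≡_; _≢_; refl; sym; trans; cong; cong₂; subst; module ≡-Reasoning)
open import Relation.Nullary using (¬_; Dec; yes; no; contradiction)
open import Relation.Nullary.Decidable using (_×-dec_)
open Polynomial using (Poly; coeff; _≈_; _+_; _*_; _^_; -_; 1#; z; const; +-rawMonoid)
open ≡-Reasoning

private
  module ℤ-+ = GroupProperties (AbelianGroup.group ℤₚ.+-0-abelianGroup)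

private
  variable
    a b ℓ : Level
    A : Set a
    B : Set b
    n : ℕ

∑ℤ : List A → (A → ℤ) → ℤ
∑ℤ = ∑ ℤ.+-0-rawMonoid

-- Indicators of decidable propositions.

⟦_⟧ : Dec A → ℤ
⟦ yes _ ⟧ = 1ℤ
⟦ no  _ ⟧ = 0ℤ

⟦⟧-true : (A? : Dec A) → A → ⟦ A? ⟧ ≡ 1ℤ
⟦⟧-true (yes _) _ = refl
⟦⟧-true (no ¬x) x = contradiction x ¬x

⟦⟧-false : (A? : Dec A) → ¬ A → ⟦ A? ⟧ ≡ 0ℤ
⟦⟧-false (yes x) ¬x = contradiction x ¬x
⟦⟧-false (no _)  _  = refl

⟦⟧-⇔ : (A? : Dec A) (B? : Dec B) → (A → B) → (B → A) → ⟦ A? ⟧ ≡ ⟦ B? ⟧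
⟦⟧-⇔ (yes x) B? f g = sym (⟦⟧-true B? (f x))
⟦⟧-⇔ (no ¬x) B? f g = sym (⟦⟧-false B? (¬x ∘ g))

⟦⟧-*-cong : (A? : Dec A) {x y : ℤ} → (A → x ≡ y) → ⟦ A? ⟧ ℤ.* x ≡ ⟦ A? ⟧ ℤ.* y
⟦⟧-*-cong (yes p) x≡y = cong (1ℤ ℤ.*_) (x≡y p)
⟦⟧-*-cong (no _)  x≡y = refl

-- The summands in the recursion of `möbius-acc` take a proof as argument; once their value no
-- longer depends on it, they become indicator times value.
whenYes-const : (A? : Dec A) {h : A → ℤ} {x : ℤ} → (∀ p → h p ≡ x) → whenYes A? h ≡ ⟦ A? ⟧ ℤ.* x
whenYes-const (yes p) h≡x = trans (h≡x p) (sym (ℤₚ.*-identityˡ _))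
whenYes-const (no _)  h≡x = refl

-- Finite sums of integers

∑-cong : (xs : List A) {g h : A → ℤ} → (∀ x → g x ≡ h x) → ∑ℤ xs g ≡ ∑ℤ xs h
∑-cong []       g≡h = refl
∑-cong (x ∷ xs) g≡h = cong₂ ℤ._+_ (g≡h x) (∑-cong xs g≡h)

∑-zero : (xs : List A) {h : A → ℤ} → (∀ {x} → x ∈ᴸ xs → h x ≡ 0ℤ) → ∑ℤ xs h ≡ 0ℤ
∑-zero []       h≡0 = refl
∑-zero (x ∷ xs) h≡0 = cong₂ ℤ._+_ (h≡0 (here refl)) (∑-zero xs (h≡0 ∘ there))

∑-+ : (xs : List A) (g h : A → ℤ) → ∑ℤ xs (λ x → g x ℤ.+ h x) ≡ ∑ℤ xs g ℤ.+ ∑ℤ xs h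
∑-+ []       g h = refl
∑-+ (x ∷ xs) g h = trans (cong (ℤ._+_ (g x ℤ.+ h x)) (∑-+ xs g h)) (interchange (g x) (h x) _ _)
  where
  interchange : ∀ i j k l → i ℤ.+ j ℤ.+ (k ℤ.+ l) ≡ i ℤ.+ k ℤ.+ (j ℤ.+ l)
  interchange = solve-∀

∑-*ˡ : (xs : List A) (i : ℤ) (h : A → ℤ) → ∑ℤ xs (λ x → i ℤ.* h x) ≡ i ℤ.* ∑ℤ xs h
∑-*ˡ []       i h = sym (ℤₚ.*-zeroʳ i)
∑-*ˡ (x ∷ xs) i h = trans (cong (ℤ._+_ (i ℤ.* h x)) (∑-*ˡ xs i h)) (sym (ℤₚ.*-distribˡ-+ i (h x) _))

∑-*ʳ : (xs : List A) (h : A → ℤ) (i : ℤ) → ∑ℤ xs (λ x → h x ℤ.* i) ≡ ∑ℤ xs h ℤ.* i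
∑-*ʳ xs h i = trans (∑-cong xs λ x → ℤₚ.*-comm (h x) i) (trans (∑-*ˡ xs i h) (ℤₚ.*-comm i _))

∑-swap : (xs : List A) (ys : List B) (h : A → B → ℤ) →
         ∑ℤ xs (λ x → ∑ℤ ys (h x)) ≡ ∑ℤ ys (λ y → ∑ℤ xs (λ x → h x y))
∑-swap []       ys h = sym (∑-zero ys λ _ → refl)
∑-swap (x ∷ xs) ys h =
  trans (cong (ℤ._+_ (∑ℤ ys (h x))) (∑-swap xs ys h)) (sym (∑-+ ys (h x) _))

∑-++ : (xs ys : List A) (h : A → ℤ) → ∑ℤ (xs ++ ys) h ≡ ∑ℤ xs h ℤ.+ ∑ℤ ys h
∑-++ []       ys h = sym (ℤₚ.+-identityˡ _)
∑-++ (x ∷ xs) ys h = trans (cong (ℤ._+_ (h x)) (∑-++ xs ys h)) (sym (ℤₚ.+-assoc (h x) _ _))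

∑-map : (g : A → B) (xs : List A) (h : B → ℤ) → ∑ℤ (map g xs) h ≡ ∑ℤ xs (h ∘ g)
∑-map g []       h = refl
∑-map g (x ∷ xs) h = cong (ℤ._+_ (h (g x))) (∑-map g xs h)

∑-cartesianProduct : (xs : List A) (ys : List B) (h : A × B → ℤ) →
  ∑ℤ (cartesianProduct xs ys) h ≡ ∑ℤ xs (λ x → ∑ℤ ys (λ y → h (x , y)))
∑-cartesianProduct []       ys h = refl
∑-cartesianProduct (x ∷ xs) ys h =
  trans (∑-++ (map (x ,_) ys) _ h) (cong₂ ℤ._+_ (∑-map (x ,_) ys h) (∑-cartesianProduct xs ys h))

∑-filter : {Q : A → Set ℓ} (Q? : ∀ x → Dec (Q x)) (xs : List A) (h : A → ℤ) →
           ∑ℤ (filter Q? xs) h ≡ ∑ℤ xs (λ x → ⟦ Q? x ⟧ ℤ.* h x)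
∑-filter Q? []       h = refl
∑-filter Q? (x ∷ xs) h with Q? x
... | yes _ = cong₂ ℤ._+_ (sym (ℤₚ.*-identityˡ (h x))) (∑-filter Q? xs h)
... | no  _ = trans (∑-filter Q? xs h) (sym (ℤₚ.+-identityˡ _))

length-filter : {Q : A → Set ℓ} (Q? : ∀ x → Dec (Q x)) (xs : List A) →
                + length (filter Q? xs) ≡ ∑ℤ xs (λ x → ⟦ Q? x ⟧)
length-filter Q? []       = refl
length-filter Q? (x ∷ xs) with Q? x
... | yes _ = cong (ℤ._+_ 1ℤ) (length-filter Q? xs)
... | no  _ = trans (length-filter Q? xs) (sym (ℤₚ.+-identityˡ _))

∑-single : {xs : List A} {x : A} → Unique xs → x ∈ᴸ xs → (h : A → ℤ) →
           (∀ y → y ≢ x → h y ≡ 0ℤ) → ∑ℤ xs h ≡ h x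
∑-single {xs = x ∷ xs} (x∉xs ∷ _) (here refl) h h≡0 =
  trans (cong (ℤ._+_ (h x)) (∑-zero xs λ y∈xs → h≡0 _ λ y≡x → All.lookup x∉xs y∈xs (sym y≡x)))
        (ℤₚ.+-identityʳ (h x))
∑-single {xs = y ∷ xs} (y∉xs ∷ u) (there x∈xs) h h≡0 =
  trans (cong₂ ℤ._+_ (h≡0 y (All.lookup y∉xs x∈xs)) (∑-single u x∈xs h h≡0))
        (ℤₚ.+-identityˡ _)

-- Coefficients of polynomials

coeff-+ : ∀ p q k → coeff (p + q) k ≡ coeff p k ℤ.+ coeff q k
coeff-+ []      q       k       = sym (ℤₚ.+-identityˡ _)
coeff-+ (x ∷ p) []      k       = sym (ℤₚ.+-identityʳ _)
coeff-+ (x ∷ p) (y ∷ q) zero    = refl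
coeff-+ (x ∷ p) (y ∷ q) (suc k) = coeff-+ p q k

coeff-map : (g : ℤ → ℤ) → g 0ℤ ≡ 0ℤ → ∀ p k → coeff (map g p) k ≡ g (coeff p k)
coeff-map g g0 []      k       = sym g0
coeff-map g g0 (x ∷ p) zero    = refl
coeff-map g g0 (x ∷ p) (suc k) = coeff-map g g0 p k

coeff-∑ : (xs : List A) (h : A → Poly) (k : ℕ) →
          coeff (∑ +-rawMonoid xs h) k ≡ ∑ℤ xs (λ x → coeff (h x) k)
coeff-∑ []       h k = refl
coeff-∑ (x ∷ xs) h k = trans (coeff-+ (h x) _ k) (cong (ℤ._+_ (coeff (h x) k)) (coeff-∑ xs h k))

-- `const x * p` unfolds to `map (x ℤ.*_) p + (0ℤ ∷ [])`; this disposes of the trailing zero.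
coeff-0∷[] : ∀ k → coeff (0ℤ ∷ []) k ≡ 0ℤ
coeff-0∷[] zero    = refl
coeff-0∷[] (suc k) = refl

coeff-∷* : ∀ x p q k → coeff ((x ∷ p) * q) k ≡ x ℤ.* coeff q k ℤ.+ coeff (0ℤ ∷ p * q) k
coeff-∷* x p q k = trans (coeff-+ (map (x ℤ.*_) q) _ k)
  (cong (ℤ._+ coeff (0ℤ ∷ p * q) k) (coeff-map (x ℤ.*_) (ℤₚ.*-zeroʳ x) q k))

coeff-const* : ∀ x p k → coeff (const x * p) k ≡ x ℤ.* coeff p k
coeff-const* x p k = trans (coeff-∷* x [] p k)
  (trans (cong (ℤ._+_ (x ℤ.* coeff p k)) (coeff-0∷[] k)) (ℤₚ.+-identityʳ _))

coeff-*const : ∀ p x k → coeff (p * const x) k ≡ coeff p k ℤ.* x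
coeff-*const []      x k       = refl
coeff-*const (y ∷ p) x zero    = ℤₚ.+-identityʳ _
coeff-*const (y ∷ p) x (suc k) = coeff-*const p x k

coeff-z*-zero : ∀ p → coeff (z * p) 0 ≡ 0ℤ
coeff-z*-zero p = coeff-∷* 0ℤ (1ℤ ∷ []) p 0

coeff-z*-suc : ∀ p k → coeff (z * p) (suc k) ≡ coeff p k
coeff-z*-suc p k = begin
  coeff (z * p) (suc k)               ≡⟨ coeff-∷* 0ℤ (1ℤ ∷ []) p (suc k) ⟩
  0ℤ ℤ.+ coeff (const 1ℤ * p) k       ≡⟨ ℤₚ.+-identityˡ _ ⟩
  coeff (const 1ℤ * p) k              ≡⟨ coeff-const* 1ℤ p k ⟩
  1ℤ ℤ.* coeff p k                    ≡⟨ ℤₚ.*-identityˡ _ ⟩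
  coeff p k                           ∎

1-z : Poly
1-z = 1# + (- z)

coeff-[1-z]*-zero : ∀ p → coeff (1-z * p) 0 ≡ coeff p 0
coeff-[1-z]*-zero p = begin
  coeff (1-z * p) 0         ≡⟨ coeff-∷* 1ℤ (-1ℤ ∷ []) p 0 ⟩
  1ℤ ℤ.* coeff p 0 ℤ.+ 0ℤ   ≡⟨ ℤₚ.+-identityʳ _ ⟩
  1ℤ ℤ.* coeff p 0          ≡⟨ ℤₚ.*-identityˡ _ ⟩
  coeff p 0                 ∎

-- Pascal's rule with signs. The summands are ordered as `subsets` splits, first the sets without
-- the new element.
coeff-[1-z]*-suc : ∀ p k → coeff (1-z * p) (suc k) ≡ -1ℤ ℤ.* coeff p k ℤ.+ coeff p (suc k)
coeff-[1-z]*-suc p k = begin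
  coeff (1-z * p) (suc k)
    ≡⟨ coeff-∷* 1ℤ (-1ℤ ∷ []) p (suc k) ⟩
  1ℤ ℤ.* coeff p (suc k) ℤ.+ coeff (const -1ℤ * p) k
    ≡⟨ cong₂ ℤ._+_ (ℤₚ.*-identityˡ (coeff p (suc k))) (coeff-const* -1ℤ p k) ⟩
  coeff p (suc k) ℤ.+ -1ℤ ℤ.* coeff p k
    ≡⟨ ℤₚ.+-comm (coeff p (suc k)) _ ⟩
  -1ℤ ℤ.* coeff p k ℤ.+ coeff p (suc k) ∎

-- Sums over the subsets of a finite set

subsets : ∀ n → List (Subset n)
subsets zero    = [] ∷ []
subsets (suc n) = map (outside ∷_) (subsets n) ++ map (inside ∷_) (subsets n)

∈-subsets : (S : Subset n) → S ∈ᴸ subsets n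
∈-subsets []            = here refl
∈-subsets (outside ∷ S) = ∈-++⁺ˡ (∈-map⁺ (outside ∷_) (∈-subsets S))
∈-subsets (inside ∷ S)  = ∈-++⁺ʳ _ (∈-map⁺ (inside ∷_) (∈-subsets S))

subsets-unique : ∀ n → Unique (subsets n)
subsets-unique zero    = All.[] ∷ []
subsets-unique (suc n) = Unique.++⁺
  (Unique.map⁺ ∷-injectiveʳ (subsets-unique n)) (Unique.map⁺ ∷-injectiveʳ (subsets-unique n)) disjoint
  where
  disjoint : ∀ {S} → ¬ (S ∈ᴸ map (outside ∷_) (subsets n) × S ∈ᴸ map (inside ∷_) (subsets n))
  disjoint (S∈out , S∈in) with ∈-map⁻ _ S∈out | ∈-map⁻ _ S∈in
  ... | _ , _ , refl | _ , _ , ()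

∑-subsets-suc : ∀ n (h : Subset (suc n) → ℤ) →
  ∑ℤ (subsets (suc n)) h ≡ ∑ℤ (subsets n) (h ∘ (outside ∷_)) ℤ.+ ∑ℤ (subsets n) (h ∘ (inside ∷_))
∑-subsets-suc n h = trans (∑-++ (map (outside ∷_) (subsets n)) _ h)
  (cong₂ ℤ._+_ (∑-map _ (subsets n) h) (∑-map _ (subsets n) h))

-- Toggling the first element of the ground set pairs subsets of opposite sign.
∑-signs : ∀ n → ∑ℤ (subsets (suc n)) (λ S → -1ℤ ℤ.^ card S) ≡ 0ℤ
∑-signs n = begin
  ∑ℤ (subsets (suc n)) (λ S → -1ℤ ℤ.^ card S)
    ≡⟨ ∑-subsets-suc n _ ⟩
  Σ ℤ.+ ∑ℤ (subsets n) (λ S → -1ℤ ℤ.* -1ℤ ℤ.^ card S)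
    ≡⟨ cong (ℤ._+_ Σ) (trans (∑-*ˡ (subsets n) -1ℤ _) (ℤₚ.-1*i≡-i Σ)) ⟩
  Σ ℤ.+ ℤ.- Σ
    ≡⟨ ℤₚ.+-inverseʳ Σ ⟩
  0ℤ ∎
  where
  Σ : ℤ
  Σ = ∑ℤ (subsets n) (λ S → -1ℤ ℤ.^ card S)

-- The coefficient of z^k in (-z)^m.
signedCoeff : ℕ → ℕ → ℤ
signedCoeff k m = -1ℤ ℤ.^ m ℤ.* coeff (z ^ m) k

signedCoeff-zero-suc : ∀ m → signedCoeff 0 (suc m) ≡ 0ℤ
signedCoeff-zero-suc m =
  trans (cong (-1ℤ ℤ.^ suc m ℤ.*_) (coeff-z*-zero (z ^ m))) (ℤₚ.*-zeroʳ (-1ℤ ℤ.^ suc m))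

signedCoeff-suc-suc : ∀ k m → signedCoeff (suc k) (suc m) ≡ -1ℤ ℤ.* signedCoeff k m
signedCoeff-suc-suc k m =
  trans (cong (-1ℤ ℤ.^ suc m ℤ.*_) (coeff-z*-suc (z ^ m) k)) (ℤₚ.*-assoc -1ℤ (-1ℤ ℤ.^ m) _)

-- The expansion of the product (1 - z)^n: an element outside `S` contributes -z, an element of `S`
-- contributes 1. The induction decides the first element. Complements appear because in an interval
-- `[p, q]` the exponent is the distance to the top.
binomial : ∀ n k → ∑ℤ (subsets n) (λ S → signedCoeff k (card (∁ S))) ≡ coeff (1-z ^ n) k
binomial zero    zero    = refl
binomial zero    (suc k) = refl
binomial (suc n) zero    = begin
  ∑ℤ (subsets (suc n)) (λ S → signedCoeff 0 (card (∁ S)))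
    ≡⟨ ∑-subsets-suc n _ ⟩
  ∑ℤ (subsets n) (λ S → signedCoeff 0 (suc (card (∁ S)))) ℤ.+
  ∑ℤ (subsets n) (λ S → signedCoeff 0 (card (∁ S)))
    ≡⟨ cong₂ ℤ._+_ (∑-zero (subsets n) λ {S} _ → signedCoeff-zero-suc (card (∁ S))) (binomial n 0) ⟩
  0ℤ ℤ.+ coeff (1-z ^ n) 0
    ≡⟨ ℤₚ.+-identityˡ _ ⟩
  coeff (1-z ^ n) 0
    ≡⟨ coeff-[1-z]*-zero (1-z ^ n) ⟨
  coeff (1-z ^ suc n) 0 ∎
binomial (suc n) (suc k) = begin
  ∑ℤ (subsets (suc n)) (λ S → signedCoeff (suc k) (card (∁ S)))
    ≡⟨ ∑-subsets-suc n _ ⟩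
  ∑ℤ (subsets n) (λ S → signedCoeff (suc k) (suc (card (∁ S)))) ℤ.+
  ∑ℤ (subsets n) (λ S → signedCoeff (suc k) (card (∁ S)))
    ≡⟨ cong₂ ℤ._+_ (trans (∑-cong (subsets n) λ S → signedCoeff-suc-suc k (card (∁ S))) (∑-*ˡ (subsets n) -1ℤ _))
         (binomial n (suc k)) ⟩
  -1ℤ ℤ.* ∑ℤ (subsets n) (λ S → signedCoeff k (card (∁ S))) ℤ.+ coeff (1-z ^ n) (suc k)
    ≡⟨ cong (λ i → -1ℤ ℤ.* i ℤ.+ coeff (1-z ^ n) (suc k)) (binomial n k) ⟩
  -1ℤ ℤ.* coeff (1-z ^ n) k ℤ.+ coeff (1-z ^ n) (suc k)
    ≡⟨ coeff-[1-z]*-suc (1-z ^ n) k ⟨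
  coeff (1-z ^ suc n) (suc k) ∎

-- Covers in the Boolean lattice

-- Adding one element to a set, as an inductive relation so that proofs can recurse on the position
-- of the new element.
data _⋖ˢ_ : Subset n → Subset n → Set where
  add  : {S : Subset n} → (outside ∷ S) ⋖ˢ (inside ∷ S)
  skip : ∀ {b} {S T : Subset n} → S ⋖ˢ T → (b ∷ S) ⋖ˢ (b ∷ T)

⋖ˢ⇒⊆ : {S T : Subset n} → S ⋖ˢ T → S ⊆ T
⋖ˢ⇒⊆ add        (there x∈S) = there x∈S
⋖ˢ⇒⊆ (skip S⋖T) = s⊆s (⋖ˢ⇒⊆ S⋖T)

⋖ˢ⇒⊉ : {S T : Subset n} → S ⋖ˢ T → ¬ (T ⊆ S)
⋖ˢ⇒⊉ add T⊆S with () ← T⊆S here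
⋖ˢ⇒⊉ (skip S⋖T) T⊆S = ⋖ˢ⇒⊉ S⋖T (drop-∷-⊆ T⊆S)

-- Off the added element `U` is squeezed between equal sets, so only its membership there is free:
-- without that element `U ⊆ S`, with it `T ⊆ U`.
⋖ˢ-noBetween : {S T U : Subset n} → S ⋖ˢ T → S ⊆ U → U ⊆ T → ¬ (U ⊆ S) → T ⊆ U
⋖ˢ-noBetween {U = outside ∷ U} add S⊆U U⊆T U⊈S = ⊥-elim (U⊈S (s⊆s (drop-∷-⊆ U⊆T)))
⋖ˢ-noBetween {U = inside ∷ U} add S⊆U U⊆T U⊈S = s⊆s (drop-∷-⊆ S⊆U)
⋖ˢ-noBetween {U = x ∷ U} (skip {b = outside} S⋖T) S⊆U U⊆T U⊈S with x
... | inside with () ← U⊆T here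
... | outside = s⊆s (⋖ˢ-noBetween S⋖T (drop-∷-⊆ S⊆U) (drop-∷-⊆ U⊆T) (U⊈S ∘ s⊆s))
⋖ˢ-noBetween {U = x ∷ U} (skip {b = inside} S⋖T) S⊆U U⊆T U⊈S with x
... | outside with () ← S⊆U here
... | inside = s⊆s (⋖ˢ-noBetween S⋖T (drop-∷-⊆ S⊆U) (drop-∷-⊆ U⊆T) (U⊈S ∘ s⊆s))

-- A set is built from `⊥` one element at a time. The recursion restricts `ρ` to the sets that avoid
-- the first element, so its base point is still the empty set; if the first element is present, one
-- `add` step removes it beforehand.
card-additive : (ρ : Subset n → ℤ) → (∀ {S T} → S ⋖ˢ T → ρ T ≡ ρ S ℤ.+ 1ℤ) →
                ∀ S → ρ S ≡ ρ ⊥ ℤ.+ + card S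
card-additive ρ step []            = sym (ℤₚ.+-identityʳ _)
card-additive ρ step (outside ∷ S) = card-additive (ρ ∘ (outside ∷_)) (step ∘ skip) S
card-additive ρ step (inside ∷ S)  = begin
  ρ (inside ∷ S)                   ≡⟨ step add ⟩
  ρ (outside ∷ S) ℤ.+ 1ℤ           ≡⟨ cong (ℤ._+ 1ℤ) (card-additive (ρ ∘ (outside ∷_)) (step ∘ skip) S) ⟩
  ρ ⊥ ℤ.+ + card S ℤ.+ 1ℤ          ≡⟨ ℤₚ.+-assoc (ρ ⊥) _ _ ⟩
  ρ ⊥ ℤ.+ + (card S ℕ.+ 1)         ≡⟨ cong (λ m → ρ ⊥ ℤ.+ + m) (ℕₚ.+-comm (card S) 1) ⟩
  ρ ⊥ ℤ.+ + suc (card S)           ∎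

card-∁ : (S : Subset n) → ∣ + n ℤ.- + card S ∣ ≡ card (∁ S)
card-∁ {n} S = begin
  ∣ + n ℤ.- + card S ∣   ≡⟨ cong ∣_∣ (trans (ℤₚ.[+m]-[+n]≡m⊖n n (card S)) (ℤₚ.⊖-≥ (∣p∣≤n S))) ⟩
  n ℕ.∸ card S           ≡⟨ ∣∁p∣≡n∸∣p∣ S ⟨
  card (∁ S)             ∎

-- Integer inequalities

≤d-1⇒<d : ∀ {i d} → i ℤ.≤ d ℤ.- 1ℤ → i ℤ.< d
≤d-1⇒<d {i} {d} i≤d-1 = ℤₚ.i≤pred[j]⇒i<j (subst (i ℤ.≤_) (ℤₚ.+-comm d -1ℤ) i≤d-1)

<d⇒≤d-1 : ∀ {i d} → i ℤ.< d → i ℤ.≤ d ℤ.- 1ℤ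
<d⇒≤d-1 {i} {d} i<d = subst (i ℤ.≤_) (ℤₚ.+-comm -1ℤ d) (ℤₚ.i<j⇒i≤pred[j] i<d)

≰d-1⇒d≤ : ∀ {i d} → ¬ (i ℤ.≤ d ℤ.- 1ℤ) → d ℤ.≤ i
≰d-1⇒d≤ i≰d-1 = ℤₚ.≮⇒≥ (i≰d-1 ∘ <d⇒≤d-1)

-- The hypothesis amounts to `i ≤ d`, so `d` is a natural number `e` and the absolute value is
-- `e + 1`.
i-1≤d-1⇒i<∣d+1∣ : ∀ i d → + i ℤ.- 1ℤ ℤ.≤ d ℤ.- 1ℤ → i ℕ.< ∣ d ℤ.+ 1ℤ ∣
i-1≤d-1⇒i<∣d+1∣ i d i-1≤d-1 with ℤₚ.≮⇒≥ {d} {+ i} (λ d<i → ℤₚ.<⇒≱ (ℤₚ.+-monoˡ-< -1ℤ d<i) i-1≤d-1)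
... | ℤ.+≤+ {n = e} i≤e = subst (i ℕ.<_) (ℕₚ.+-comm 1 e) (ℕ.s≤s i≤e)

-- For d < -1 the absolute value in ranksBelow d produces spurious ranks; the hypothesis
-- i - 1 ≤ d rules this case out.
i<∣d+1∣⇒i-1≤d-1 : ∀ i d → + i ℤ.- 1ℤ ℤ.≤ d → i ℕ.< ∣ d ℤ.+ 1ℤ ∣ → + i ℤ.- 1ℤ ℤ.≤ d ℤ.- 1ℤ
i<∣d+1∣⇒i-1≤d-1 i (+ e) _ i<e+1 =
  ℤₚ.+-monoˡ-≤ -1ℤ (ℤ.+≤+ (ℕ.s≤s⁻¹ (subst (i ℕ.<_) (ℕₚ.+-comm e 1) i<e+1)))
i<∣d+1∣⇒i-1≤d-1 (suc i) ℤ.-[1+ e ] () _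
i<∣d+1∣⇒i-1≤d-1 zero ℤ.-[1+ zero ] _ ()
i<∣d+1∣⇒i-1≤d-1 zero ℤ.-[1+ suc e ] (ℤ.-≤- ()) _

-- Finite ranked posets

module _ {c ℓ₁ ℓ₂} (P : FinitePoset c ℓ₁ ℓ₂) where

  open FinitePoset P renaming (A to X; _≈_ to _≈ᴾ_; refl to ≤-refl; trans to ≤-trans)

  private
    _⋖ᴾ_ : X → X → Set _
    _⋖ᴾ_ = _⋖_ poset

  -- `elements` holds one representative of each class of `≈ᴾ`, and `t` itself need not be listed:
  -- the surviving term sits at `from (to t)`, and `h-cong` moves its value to `t`.
  ∑-elements : (h : X → ℤ) → (∀ {s t} → s ≈ᴾ t → h s ≡ h t) →
               ∀ t → (∀ s → ¬ (s ≈ᴾ t) → h s ≡ 0ℤ) → ∑ℤ elements h ≡ h t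
  ∑-elements h h-cong t h≡0 = begin
    ∑ℤ elements h                        ≡⟨ cong (λ xs → ∑ℤ xs h) (map-tabulate id from) ⟨
    ∑ℤ (map from (List.allFin size)) h   ≡⟨ ∑-map from (List.allFin size) h ⟩
    ∑ℤ (List.allFin size) (h ∘ from)     ≡⟨ ∑-single (Unique.allFin⁺ size) (∈-allFin (to t)) (h ∘ from) vanish ⟩
    h (from (to t))                      ≡⟨ h-cong (strictlyInverseʳ t) ⟩
    h t                                  ∎
    where
    vanish : ∀ i → i ≢ to t → h (from i) ≡ 0ℤ
    vanish i i≢ = h≡0 (from i) λ from-i≈t → i≢ (sym (Inverse.inverseˡ enumeration (Eq.sym from-i≈t)))

  <-trans : ∀ {x y w} → x < y → y < w → x < w
  <-trans = ToStrict.<-trans _≈ᴾ_ _≤_ isPartialOrder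

  -- One scan of the list finds a coatom: x moves up to t whenever t lies in between, and the
  -- elements already scanned stay excluded by transitivity.
  coatomAvoiding : (xs : List X) → ∀ {s q} → s < q →
    ∃ λ x → s ≤ x × x < q × All (λ t → ¬ (x < t × t < q)) xs
  coatomAvoiding []       s<q = _ , ≤-refl , s<q , All.[]
  coatomAvoiding (t ∷ ts) s<q with coatomAvoiding ts s<q
  ... | x , s≤x , x<q , free with (x <? t) ×-dec (t <? _)
  ...   | no  ¬x<t<q        = x , s≤x , x<q , ¬x<t<q All.∷ free
  ...   | yes (x<t , t<q) = t , ≤-trans s≤x (proj₁ x<t) , t<q ,
    (λ (t<t , _) → proj₂ t<t Eq.refl) All.∷ All.map (λ ¬x<u<q (t<u , u<q) → ¬x<u<q (<-trans x<t t<u , u<q)) free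

  coatom : ∀ {s q} → s < q → ∃ λ x → s ≤ x × x ⋖ᴾ q
  coatom s<q with coatomAvoiding elements s<q
  ... | x , s≤x , x<q , free = x , s≤x , x<q , λ (t , x<t , t<q) →
    -- Only representatives were scanned, so `t` is replaced by the equivalent `from (to t)`.
    All.lookup free (∈-tabulate⁺ (to t))
      (proj₁ resp (Eq.sym (strictlyInverseʳ t)) x<t , proj₂ resp (Eq.sym (strictlyInverseʳ t)) t<q)
    where resp = <-resp-≈ (DecPoset.Eq.isEquivalence decPoset) ≤-resp-≈

  -- An isomorphism from the subsets of an `n`-set onto `[p, q]`, with values in `X` and the bounds
  -- as separate fields, so that a sum over `elements` can be reindexed by `subsets n`. Surjectivity
  -- is up to `≈ᴾ`.
  record BooleanInterval (p q : X) (n : ℕ) : Set (c ⊔ ℓ₁ ⊔ ℓ₂) where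
    field
      embed    : Subset n → X
      mono     : ∀ {S T} → S ⊆ T → embed S ≤ embed T
      reflects : ∀ {S T} → embed S ≤ embed T → S ⊆ T
      lower    : ∀ S → p ≤ embed S
      upper    : ∀ S → embed S ≤ q
      covers   : ∀ {s} → p ≤ s → s ≤ q → ∃ λ S → embed S ≈ᴾ s

    embed-injective : ∀ {S T} → embed S ≈ᴾ embed T → S ≡ T
    embed-injective eq = ⊆-antisym (reflects (reflexive eq)) (reflects (reflexive (Eq.sym eq)))

    p≤q : p ≤ q
    p≤q = ≤-trans (lower ⊥) (upper ⊥)

    embed-⊥ : embed ⊥ ≈ᴾ p
    embed-⊥ with covers ≤-refl p≤q
    ... | S , eq = antisym (≤-trans (mono (⊥⊆ {p = S})) (reflexive eq)) (lower ⊥)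

    embed-⊤ : embed ⊤ ≈ᴾ q
    embed-⊤ with covers p≤q ≤-refl
    ... | S , eq = antisym (upper ⊤) (≤-trans (reflexive (Eq.sym eq)) (mono (⊆⊤ {p = S})))

    -- An element between the two images lies in `[p, q]`, hence is an image itself, and
    -- `⋖ˢ-noBetween` applies. The result is a cover in the whole poset, which is what the rank
    -- axiom speaks of.
    embed-⋖ : ∀ {S T} → S ⋖ˢ T → embed S ⋖ᴾ embed T
    embed-⋖ {S} {T} S⋖T =
      (mono (⋖ˢ⇒⊆ S⋖T) , λ eq → ⋖ˢ⇒⊉ S⋖T (reflects (reflexive (Eq.sym eq)))) , between
      where
      between : ¬ ∃ λ s → embed S < s × s < embed T
      between (s , (S≤s , S≉s) , (s≤T , s≉T))
        with covers (≤-trans (lower S) S≤s) (≤-trans s≤T (upper T))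
      ... | U , U≈s = s≉T (antisym s≤T (≤-trans (mono T⊆U) (reflexive U≈s)))
        where
        T⊆U : T ⊆ U
        T⊆U = ⋖ˢ-noBetween S⋖T
          (reflects (≤-trans S≤s (reflexive (Eq.sym U≈s))))
          (reflects (≤-trans (reflexive U≈s) s≤T))
          (λ U⊆S → S≉s (antisym S≤s (≤-trans (reflexive (Eq.sym U≈s)) (mono U⊆S))))

    -- Double counting of the pairs with `embed S ≈ᴾ s`: an `s` in the interval has exactly one such
    -- `S`, any other `s` has none, and each `S` meets exactly one listed element.
    ∑-interval : (h : X → ℤ) → (∀ {s t} → s ≈ᴾ t → h s ≡ h t) →
      ∑ℤ elements (λ s → ⟦ p ≤? s ×-dec s ≤? q ⟧ ℤ.* h s) ≡ ∑ℤ (subsets n) (h ∘ embed)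
    ∑-interval h h-cong = begin
      ∑ℤ elements (λ s → ⟦ p ≤? s ×-dec s ≤? q ⟧ ℤ.* h s)
        ≡⟨ ∑-cong elements (λ s → cong (ℤ._* h s) (indicator s)) ⟩
      ∑ℤ elements (λ s → ∑ℤ (subsets n) (λ S → ⟦ embed S ≟ s ⟧) ℤ.* h s)
        ≡⟨ ∑-cong elements (λ s → ∑-*ʳ (subsets n) _ (h s)) ⟨
      ∑ℤ elements (λ s → ∑ℤ (subsets n) (λ S → ⟦ embed S ≟ s ⟧ ℤ.* h s))
        ≡⟨ ∑-swap elements (subsets n) _ ⟩
      ∑ℤ (subsets n) (λ S → ∑ℤ elements (λ s → ⟦ embed S ≟ s ⟧ ℤ.* h s))
        ≡⟨ ∑-cong (subsets n) pick ⟩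
      ∑ℤ (subsets n) (h ∘ embed) ∎
      where
      indicator : ∀ s → ⟦ p ≤? s ×-dec s ≤? q ⟧ ≡ ∑ℤ (subsets n) (λ S → ⟦ embed S ≟ s ⟧)
      indicator s with p ≤? s ×-dec s ≤? q
      ... | no ∉[p,q] = sym (∑-zero (subsets n) λ {S} _ → ⟦⟧-false (embed S ≟ s) λ eq →
              ∉[p,q] ( ≤-trans (lower S) (reflexive eq)
                     , ≤-trans (reflexive (Eq.sym eq)) (upper S)))
      ... | yes (p≤s , s≤q) with covers p≤s s≤q
      ...   | S , S≈s = sym (trans
              (∑-single (subsets-unique n) (∈-subsets S) _ λ T T≢S →
                ⟦⟧-false (embed T ≟ s) λ T≈s → T≢S (embed-injective (Eq.trans T≈s (Eq.sym S≈s))))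
              (⟦⟧-true (embed S ≟ s) S≈s))

      pick : ∀ S → ∑ℤ elements (λ s → ⟦ embed S ≟ s ⟧ ℤ.* h s) ≡ h (embed S)
      pick S = begin
        ∑ℤ elements (λ s → ⟦ embed S ≟ s ⟧ ℤ.* h s)
          ≡⟨ ∑-elements _ (λ {s} {t} s≈t → cong₂ ℤ._*_
               (⟦⟧-⇔ (embed S ≟ s) (embed S ≟ t) (λ eq → Eq.trans eq s≈t) (λ eq → Eq.trans eq (Eq.sym s≈t)))
               (h-cong s≈t))
             (embed S) (λ s s≉S → cong (ℤ._* h s) (⟦⟧-false (embed S ≟ s) (s≉S ∘ Eq.sym))) ⟩
        ⟦ embed S ≟ embed S ⟧ ℤ.* h (embed S)
          ≡⟨ cong (ℤ._* h (embed S)) (⟦⟧-true (embed S ≟ embed S) Eq.refl) ⟩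
        1ℤ ℤ.* h (embed S)
          ≡⟨ ℤₚ.*-identityˡ _ ⟩
        h (embed S) ∎

  -- Ranks and Möbius values on Boolean intervals.

  module _ (rank : X → ℤ) (isRanked : IsRanked poset rank) where

    open IsRanked isRanked

    -- Ranks are compared only along covers, so the proof descends from `q` through coatoms that
    -- stay above `s`.
    rank-mono : ∀ {s q} → s ≤ q → rank s ℤ.≤ rank q
    rank-mono {q = q} = go (<-wellFounded q)
      where
      go : ∀ {s q} → Acc _<_ q → s ≤ q → rank s ℤ.≤ rank q
      go {s} {q} (acc rs) s≤q with s ≟ q
      ... | yes s≈q = ℤₚ.≤-reflexive (rank-cong s≈q)
      ... | no  s≉q with coatom (s≤q , s≉q)
      ...   | x , s≤x , x⋖q = ℤₚ.≤-trans (go (rs (proj₁ x⋖q)) s≤x)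
              (subst (rank x ℤ.≤_) (sym (rank-cover x⋖q)) (ℤₚ.i≤i+j (rank x) 1ℤ))

    module _ {p q n} (I : BooleanInterval p q n) where

      open BooleanInterval I

      rank-embed : ∀ S → rank (embed S) ≡ rank p ℤ.+ + card S
      rank-embed S = trans (card-additive (rank ∘ embed) (rank-cover ∘ embed-⋖) S)
        (cong (ℤ._+ + card S) (rank-cong embed-⊥))

      rank-top : rank q ≡ rank p ℤ.+ + n
      rank-top = begin
        rank q                      ≡⟨ rank-cong embed-⊤ ⟨
        rank (embed ⊤)              ≡⟨ rank-embed ⊤ ⟩
        rank p ℤ.+ + card {n} ⊤     ≡⟨ cong (λ m → rank p ℤ.+ + m) (∣⊤∣≡n n) ⟩
        rank p ℤ.+ + n              ∎

      rank-above : ∀ S → ∣ rank (embed S) ℤ.- rank p ∣ ≡ card S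
      rank-above S = cong ∣_∣ (trans (cong (ℤ._- rank p) (rank-embed S)) (cancel (rank p) (+ card S)))
        where
        cancel : ∀ i j → i ℤ.+ j ℤ.- i ≡ j
        cancel = solve-∀

      rank-below : ∀ S → ∣ rank q ℤ.- rank (embed S) ∣ ≡ card (∁ S)
      rank-below S = trans
        (cong ∣_∣ (trans (cong₂ ℤ._-_ rank-top (rank-embed S)) (cancel (rank p) (+ n) (+ card S))))
        (card-∁ S)
        where
        cancel : ∀ i j k → i ℤ.+ j ℤ.- (i ℤ.+ k) ≡ j ℤ.- k
        cancel = solve-∀

    sign : X → X → ℤ
    sign p q = -1ℤ ℤ.^ ∣ rank q ℤ.- rank p ∣

    sign-cong : ∀ p {s t} → s ≈ᴾ t → sign p s ≡ sign p t
    sign-cong p s≈t = cong (λ i → -1ℤ ℤ.^ ∣ i ℤ.- rank p ∣) (rank-cong s≈t)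

    sign-refl : ∀ {p q} → p ≈ᴾ q → sign p q ≡ 1ℤ
    sign-refl {p} p≈q = trans (sym (sign-cong p p≈q))
      (cong (λ i → -1ℤ ℤ.^ ∣ i ∣) (ℤₚ.+-inverseʳ (rank p)))

    -- `sign p` satisfies the identity that defines the Möbius function: reindexed by subsets, the
    -- sum becomes that of `∑-signs`.
    ∑-sign : ∀ {p q n} → BooleanInterval p q n → ¬ (p ≈ᴾ q) →
             ∑ℤ elements (λ s → ⟦ p ≤? s ×-dec s ≤? q ⟧ ℤ.* sign p s) ≡ 0ℤ
    -- In dimension 0 the sets `⊥` and `⊤` coincide, which would make `p` and `q` equivalent.
    ∑-sign {n = zero} I p≉q = contradiction (Eq.trans (Eq.sym embed-⊥) embed-⊤) p≉q
      where open BooleanInterval I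
    ∑-sign {p} {q} {suc n} I p≉q = begin
      ∑ℤ elements (λ s → ⟦ p ≤? s ×-dec s ≤? q ⟧ ℤ.* sign p s)
        ≡⟨ ∑-interval (sign p) (sign-cong p) ⟩
      ∑ℤ (subsets (suc n)) (sign p ∘ embed)
        ≡⟨ ∑-cong (subsets (suc n)) (λ S → cong (-1ℤ ℤ.^_) (rank-above I S)) ⟩
      ∑ℤ (subsets (suc n)) (λ S → -1ℤ ℤ.^ card S)
        ≡⟨ ∑-signs n ⟩
      0ℤ ∎
      where open BooleanInterval I

    -- The Möbius recursion stops strictly below `q`, whereas `∑-interval` treats closed intervals;
    -- this passes between the two.
    ∑-half-open : ∀ {p q} → p ≤ q → (h : X → ℤ) → (∀ {s t} → s ≈ᴾ t → h s ≡ h t) →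
      ∑ℤ elements (λ s → ⟦ p ≤? s ×-dec s ≤? q ⟧ ℤ.* h s) ≡
      ∑ℤ elements (λ s → ⟦ p ≤? s ×-dec s <? q ⟧ ℤ.* h s) ℤ.+ h q
    ∑-half-open {p} {q} p≤q h h-cong = begin
      ∑ℤ elements (λ s → ⟦ p ≤? s ×-dec s ≤? q ⟧ ℤ.* h s)
        ≡⟨ ∑-cong elements split ⟩
      ∑ℤ elements (λ s → ⟦ p ≤? s ×-dec s <? q ⟧ ℤ.* h s ℤ.+ ⟦ s ≟ q ⟧ ℤ.* h s)
        ≡⟨ ∑-+ elements _ _ ⟩
      ∑ℤ elements (λ s → ⟦ p ≤? s ×-dec s <? q ⟧ ℤ.* h s) ℤ.+ ∑ℤ elements (λ s → ⟦ s ≟ q ⟧ ℤ.* h s)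
        ≡⟨ cong (ℤ._+_ (∑ℤ elements (λ s → ⟦ p ≤? s ×-dec s <? q ⟧ ℤ.* h s))) pick ⟩
      ∑ℤ elements (λ s → ⟦ p ≤? s ×-dec s <? q ⟧ ℤ.* h s) ℤ.+ h q ∎
      where
      split : ∀ s → ⟦ p ≤? s ×-dec s ≤? q ⟧ ℤ.* h s ≡
                    ⟦ p ≤? s ×-dec s <? q ⟧ ℤ.* h s ℤ.+ ⟦ s ≟ q ⟧ ℤ.* h s
      split s = trans (cong (ℤ._* h s) (indicators (s ≟ q))) (ℤₚ.*-distribʳ-+ (h s) ⟦ p ≤? s ×-dec s <? q ⟧ _)
        where
        indicators : (eq? : Dec (s ≈ᴾ q)) →
          ⟦ p ≤? s ×-dec s ≤? q ⟧ ≡ ⟦ p ≤? s ×-dec s <? q ⟧ ℤ.+ ⟦ eq? ⟧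
        indicators (yes s≈q) = trans
          (⟦⟧-true (p ≤? s ×-dec s ≤? q) (≤-trans p≤q (reflexive (Eq.sym s≈q)) , reflexive s≈q))
          (cong (ℤ._+ 1ℤ) (sym (⟦⟧-false (p ≤? s ×-dec s <? q) λ (_ , _ , s≉q) → s≉q s≈q)))
        indicators (no s≉q) = trans
          (⟦⟧-⇔ (p ≤? s ×-dec s ≤? q) (p ≤? s ×-dec s <? q) (λ (l , u) → l , u , s≉q) (λ (l , u) → l , proj₁ u))
          (sym (ℤₚ.+-identityʳ _))

      pick : ∑ℤ elements (λ s → ⟦ s ≟ q ⟧ ℤ.* h s) ≡ h q
      pick = trans
        (∑-elements _ (λ {s} {t} s≈t → cong₂ ℤ._*_
            (⟦⟧-⇔ (s ≟ q) (t ≟ q) (Eq.trans (Eq.sym s≈t)) (Eq.trans s≈t)) (h-cong s≈t))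
          q (λ s s≉q → cong (ℤ._* h s) (⟦⟧-false (s ≟ q) s≉q)))
        (trans (cong (ℤ._* h q) (⟦⟧-true (q ≟ q) Eq.refl)) (ℤₚ.*-identityˡ (h q)))

    -- The value depends on ranks only, so the summands of the recursion become functions that
    -- respect ≈ and do not mention the accessibility proofs.
    möbius-acc-boolean : ∀ {p q} (w : Acc _<_ q) → p ≤ q →
      (∀ {s} → p ≤ s → s ≤ q → ∃ (BooleanInterval p s)) → möbius-acc P p q w ≡ sign p q
    möbius-acc-boolean {p} {q} (acc rs) p≤q boolean with p ≤? q | p ≟ q
    ... | no  p≰q | _       = contradiction p≤q p≰q
    ... | yes _   | yes p≈q = sym (sign-refl p≈q)
    ... | yes _   | no  p≉q = begin
      ℤ.- ∑ℤ elements (λ s → whenYes (p ≤? s ×-dec s <? q) (λ (_ , s<q) → möbius-acc P p s (rs s<q)))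
        ≡⟨ cong ℤ.-_ (∑-cong elements λ s → whenYes-const (p ≤? s ×-dec s <? q) λ (p≤s , s<q) →
             möbius-acc-boolean (rs s<q) p≤s (λ p≤t t≤s → boolean p≤t (≤-trans t≤s (proj₁ s<q)))) ⟩
      ℤ.- Σ
        -- The missing top term is added and subtracted; it completes `Σ` to the sum over the closed
        -- interval, which is 0.
        ≡⟨ isolate Σ (sign p q) ⟩
      sign p q ℤ.- (Σ ℤ.+ sign p q)
        ≡⟨ cong (λ i → sign p q ℤ.- i) (∑-half-open p≤q (sign p) (sign-cong p)) ⟨
      sign p q ℤ.- ∑ℤ elements (λ s → ⟦ p ≤? s ×-dec s ≤? q ⟧ ℤ.* sign p s)
        ≡⟨ cong (λ i → sign p q ℤ.- i) (∑-sign (proj₂ (boolean p≤q ≤-refl)) p≉q) ⟩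
      sign p q ℤ.- 0ℤ
        ≡⟨ ℤₚ.+-identityʳ _ ⟩
      sign p q ∎
      where
      Σ : ℤ
      Σ = ∑ℤ elements (λ s → ⟦ p ≤? s ×-dec s <? q ⟧ ℤ.* sign p s)

      isolate : ∀ i j → ℤ.- i ≡ j ℤ.- (i ℤ.+ j)
      isolate = solve-∀

  -- Near-simplicial posets.

  module _ (rank : X → ℤ) (d : ℤ) (near : IsNearSimplicial poset rank d) where

    open IsNearSimplicial near
    open IsRanked isRanked using (rank-cong)
    open HasRank hasRank using (bounded)
    open IsDisjointUnionOfPointedSimplicial lower

    private
      Low : X → Set
      Low q = rank q ℤ.≤ d ℤ.- 1ℤ

      low-down : ∀ {s q} → s ≤ q → Low q → Low s
      low-down s≤q = ℤₚ.≤-trans (rank-mono rank isRanked s≤q)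

    -- By `rank-mono` and `incomparable`, everything below `q` is low and in the component of `q`,
    -- so `[p, q]` is an interval of one simplicial part. The given isomorphism `φ` leads from the
    -- interval to the subsets; `embed` is its inverse, and `mono`, `reflects` and `covers` come
    -- from `φ` through `φ-embed`.
    boolean : ∀ {p q} → p ≤ q → Low q → ∃ (BooleanInterval p q)
    boolean {p} {q} p≤q q-low = dim , record
      { embed    = embed
      ; mono     = λ {S} {T} S⊆T → cancel (λ {x} x∈ →
                     subst (x ∈_) (sym (φ-embed T)) (S⊆T (subst (x ∈_) (φ-embed S) x∈)))
      ; reflects = λ {S} {T} S≤T {x} x∈S →
                     subst (x ∈_) (φ-embed T) (φ-mono S≤T (subst (x ∈_) (sym (φ-embed S)) x∈S))
      ; lower    = λ S → proj₁ (proj₂ (proj₁ (surjective S)))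
      ; upper    = λ S → proj₂ (proj₂ (proj₁ (surjective S)))
      ; covers   = λ {s} p≤s s≤q →
                     let s′ = ((s , low-down s≤q q-low) , incomparable s≤q) , p≤s , s≤q
                     in φ s′ , injective (φ-embed (φ s′))
      }
      where
      interval-iso = IsSimplicial.interval-boolean (simplicial (component (q , q-low)))
        ((p , low-down p≤q q-low) , incomparable p≤q) ((q , q-low) , refl) p≤q
      dim = proj₁ interval-iso
      φ = proj₁ (proj₂ interval-iso)
      open IsOrderIsomorphism (proj₂ (proj₂ interval-iso))
        using (cancel; injective; surjective) renaming (mono to φ-mono)

      embed : Subset dim → X
      -- The innermost projection takes the preimage under `φ`; the other three forget the interval,
      -- the component and the rank bound.
      embed S = proj₁ (proj₁ (proj₁ (proj₁ (surjective S))))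

      φ-embed : ∀ S → φ (proj₁ (surjective S)) ≡ S
      φ-embed S = proj₂ (surjective S) Eq.refl

    -- The minimum of the component of `q` serves: it is minimal there, so the rank axioms of that
    -- part give it rank -1, and whatever lies below `q` belongs to the same part.
    bottom : ∀ {q} → Low q → ∃ λ m → rank m ≡ -1ℤ × (∀ {s} → s ≤ q → m ≤ s)
    bottom {q} q-low with minimum (component (q , q-low))
    ... | m , m-min = proj₁ (proj₁ m)
        , IsRanked.rank-minimal (IsSimplicial.isRanked (simplicial (component (q , q-low)))) {m}
            (λ s s≤m → antisym s≤m (m-min s))
        , λ {s} s≤q → m-min ((s , low-down s≤q q-low) , incomparable s≤q)

    μ-low : ∀ {p q} → p ≤ q → Low q → μ P p q ≡ sign rank isRanked p q
    μ-low {q = q} p≤q q-low = möbius-acc-boolean rank isRanked (<-wellFounded q) p≤q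
      (λ p≤s s≤q → boolean p≤s (low-down s≤q q-low))

    term : ℕ → X → X → ℤ
    term k p q = coeff (μ[z] P rank (p , q)) k

    ∑-term-low : ∀ k {q} → Low q →
      ∑ℤ elements (λ p → ⟦ p ≤? q ⟧ ℤ.* term k p q) ≡ coeff (1-z ^ ∣ rank q ℤ.+ 1ℤ ∣) k
    ∑-term-low k {q} q-low with bottom q-low
    ... | m , rank-m , m≤ with boolean (m≤ ≤-refl) q-low
    ...   | n , I = begin
      ∑ℤ elements (λ p → ⟦ p ≤? q ⟧ ℤ.* term k p q)
        -- The Möbius value is known only for `p ≤ q`, so it is replaced under the indicator.
        ≡⟨ ∑-cong elements (λ p → trans (⟦⟧-*-cong (p ≤? q) (λ p≤q → term-low p≤q))
             (cong (ℤ._* signed p) (indicator p))) ⟩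
      ∑ℤ elements (λ p → ⟦ m ≤? p ×-dec p ≤? q ⟧ ℤ.* signed p)
        ≡⟨ ∑-interval signed (λ s≈t → cong (λ i → signedCoeff k ∣ rank q ℤ.- i ∣) (rank-cong s≈t)) ⟩
      ∑ℤ (subsets n) (signed ∘ embed)
        ≡⟨ ∑-cong (subsets n) (λ S → cong (signedCoeff k) (rank-below rank isRanked I S)) ⟩
      ∑ℤ (subsets n) (λ S → signedCoeff k (card (∁ S)))
        ≡⟨ binomial n k ⟩
      coeff (1-z ^ n) k
        ≡⟨ cong (λ i → coeff (1-z ^ i) k) n≡ ⟩
      coeff (1-z ^ ∣ rank q ℤ.+ 1ℤ ∣) k ∎
      where
      open BooleanInterval I

      signed : X → ℤ
      signed p = signedCoeff k ∣ rank q ℤ.- rank p ∣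

      term-low : ∀ {p} → p ≤ q → term k p q ≡ signed p
      term-low {p} p≤q = trans (coeff-const* (μ P p q) (z ^ e) k) (cong (ℤ._* coeff (z ^ e) k) (μ-low p≤q q-low))
        where
        e : ℕ
        e = ∣ rank q ℤ.- rank p ∣

      indicator : ∀ p → ⟦ p ≤? q ⟧ ≡ ⟦ m ≤? p ×-dec p ≤? q ⟧
      indicator p = ⟦⟧-⇔ (p ≤? q) (m ≤? p ×-dec p ≤? q) (λ p≤q → m≤ p≤q , p≤q) proj₂

      n≡ : n ≡ ∣ rank q ℤ.+ 1ℤ ∣
      n≡ = cong ∣_∣ (sym (trans (cong (ℤ._+ 1ℤ) (trans (rank-top rank isRanked I) (cong (ℤ._+ + n) rank-m))) (shift (+ n))))
        where
        shift : ∀ i → -1ℤ ℤ.+ i ℤ.+ 1ℤ ≡ i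
        shift = solve-∀

    -- Summation by rank and over pairs.

    private
      C : ℕ → ℤ → ℤ
      C k r = coeff (1-z ^ ∣ r ℤ.+ 1ℤ ∣) k

      low? : ∀ q → Dec (Low q)
      low? q = rank q ℤ.≤? d ℤ.- 1ℤ

    -- `rank q` occurs in `ranksBelow d` exactly once if `q` is low, and never otherwise.
    ∑-ranksBelow : (h : ℤ → ℤ) (q : X) →
      ∑ℤ (ranksBelow d) (λ r → h r ℤ.* ⟦ rank q ℤ.≟ r ⟧) ≡ ⟦ low? q ⟧ ℤ.* h (rank q)
    ∑-ranksBelow h q = trans (∑-map (λ i → + i ℤ.- 1ℤ) (upTo ∣ d ℤ.+ 1ℤ ∣) _) (step (low? q))
      where
      summand : ℕ → ℤ
      summand i = h (+ i ℤ.- 1ℤ) ℤ.* ⟦ rank q ℤ.≟ + i ℤ.- 1ℤ ⟧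

      vanish : ∀ i → rank q ≢ + i ℤ.- 1ℤ → summand i ≡ 0ℤ
      vanish i ≢ = trans (cong (h (+ i ℤ.- 1ℤ) ℤ.*_) (⟦⟧-false (rank q ℤ.≟ + i ℤ.- 1ℤ) ≢)) (ℤₚ.*-zeroʳ (h (+ i ℤ.- 1ℤ)))

      step : (low : Dec (Low q)) → ∑ℤ (upTo ∣ d ℤ.+ 1ℤ ∣) summand ≡ ⟦ low ⟧ ℤ.* h (rank q)
      -- `bounded q` excludes the spurious entries, so a listed `rank q` would be at most `d - 1`.
      step (no ¬low) = ∑-zero (upTo ∣ d ℤ.+ 1ℤ ∣) λ {i} i∈ → vanish i λ eq →
        ¬low (subst (ℤ._≤ d ℤ.- 1ℤ) (sym eq)
          (i<∣d+1∣⇒i-1≤d-1 i d (subst (ℤ._≤ d) eq (bounded q)) (∈-upTo⁻ i∈)))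
      step (yes low) with bottom low
      -- The position of `rank q` in the list is the dimension `n` of `[m, q]`, since
      -- `rank q = n - 1`.
      ... | m , rank-m , m≤ with boolean (m≤ ≤-refl) low
      ...   | n , I = begin
        ∑ℤ (upTo ∣ d ℤ.+ 1ℤ ∣) summand
          ≡⟨ ∑-single (Unique.upTo⁺ _)
               (∈-upTo⁺ (i-1≤d-1⇒i<∣d+1∣ n d (subst (ℤ._≤ d ℤ.- 1ℤ) rank-q low)))
               summand
               (λ i i≢n → vanish i λ eq → i≢n (ℤₚ.+-injective (ℤ-+.∙-cancelʳ -1ℤ (+ i) (+ n) (trans (sym eq) rank-q)))) ⟩
        summand n
          ≡⟨ cong (λ r → h r ℤ.* ⟦ rank q ℤ.≟ r ⟧) rank-q ⟨
        h (rank q) ℤ.* ⟦ rank q ℤ.≟ rank q ⟧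
          ≡⟨ cong (h (rank q) ℤ.*_) (⟦⟧-true (rank q ℤ.≟ rank q) refl) ⟩
        h (rank q) ℤ.* 1ℤ
          ≡⟨ ℤₚ.*-comm (h (rank q)) 1ℤ ⟩
        1ℤ ℤ.* h (rank q) ∎
        where
        rank-q : rank q ≡ + n ℤ.- 1ℤ
        rank-q = trans (rank-top rank isRanked I) (trans (cong (ℤ._+ + n) rank-m) (ℤₚ.+-comm -1ℤ (+ n)))

    -- Groups the low elements by rank: `f` counts once per element, and exchanging the sums leaves
    -- for each `q` only the rank that it has.
    ∑-f : (h : ℤ → ℤ) → ∑ℤ (ranksBelow d) (λ r → h r ℤ.* + f P rank r) ≡
                        ∑ℤ elements (λ q → ⟦ low? q ⟧ ℤ.* h (rank q))
    ∑-f h = begin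
      ∑ℤ (ranksBelow d) (λ r → h r ℤ.* + f P rank r)
        ≡⟨ ∑-cong (ranksBelow d) (λ r → trans
             (cong (h r ℤ.*_) (length-filter (λ q → rank q ℤ.≟ r) elements)) (sym (∑-*ˡ elements (h r) _))) ⟩
      ∑ℤ (ranksBelow d) (λ r → ∑ℤ elements (λ q → h r ℤ.* ⟦ rank q ℤ.≟ r ⟧))
        ≡⟨ ∑-swap (ranksBelow d) elements _ ⟩
      ∑ℤ elements (λ q → ∑ℤ (ranksBelow d) (λ r → h r ℤ.* ⟦ rank q ℤ.≟ r ⟧))
        ≡⟨ ∑-cong elements (∑-ranksBelow h) ⟩
      ∑ℤ elements (λ q → ⟦ low? q ⟧ ℤ.* h (rank q)) ∎

    -- `q` is summed outermost because the two sides are compared for each upper element separately.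
    ∑-pairs : ∀ {ℓ} {Q : X × X → Set ℓ} (Q? : ∀ pq → Dec (Q pq)) (k : ℕ) →
      coeff (∑ +-rawMonoid (filter Q? (cartesianProduct elements elements)) (μ[z] P rank)) k ≡
      ∑ℤ elements (λ q → ∑ℤ elements (λ p → ⟦ Q? (p , q) ⟧ ℤ.* term k p q))
    ∑-pairs Q? k = begin
      coeff (∑ +-rawMonoid (filter Q? (cartesianProduct elements elements)) (μ[z] P rank)) k
        ≡⟨ coeff-∑ (filter Q? (cartesianProduct elements elements)) (μ[z] P rank) k ⟩
      ∑ℤ (filter Q? (cartesianProduct elements elements)) (λ pq → coeff (μ[z] P rank pq) k)
        ≡⟨ ∑-filter Q? (cartesianProduct elements elements) _ ⟩
      ∑ℤ (cartesianProduct elements elements) (λ pq → ⟦ Q? pq ⟧ ℤ.* coeff (μ[z] P rank pq) k)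
        ≡⟨ ∑-cartesianProduct elements elements _ ⟩
      ∑ℤ elements (λ p → ∑ℤ elements (λ q → ⟦ Q? (p , q) ⟧ ℤ.* term k p q))
        ≡⟨ ∑-swap elements elements _ ⟩
      ∑ℤ elements (λ q → ∑ℤ elements (λ p → ⟦ Q? (p , q) ⟧ ℤ.* term k p q)) ∎

    -- The same decision procedure as in the filter of `g`, so that `∑-pairs` applies to `g` by
    -- definition.
    crosses? : ∀ p q → Dec (p ≤ q × rank p ℤ.≤ d × d ℤ.≤ rank q)
    crosses? p q = p ≤? q ×-dec (rank p ℤ.≤? d ×-dec d ℤ.≤? rank q)

    -- The contribution of a fixed upper element `q` to the theorem; on the right exactly one of the
    -- two summands can be present, according to whether `q` is low.
    column : ∀ k q →
      ∑ℤ elements (λ p → ⟦ p ≤? q ⟧ ℤ.* term k p q) ≡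
      ∑ℤ elements (λ p → ⟦ crosses? p q ⟧ ℤ.* term k p q) ℤ.+ ⟦ low? q ⟧ ℤ.* C k (rank q)
    column k q with low? q
    ... | yes low = begin
      ∑ℤ elements (λ p → ⟦ p ≤? q ⟧ ℤ.* term k p q)
        ≡⟨ ∑-term-low k low ⟩
      C k (rank q)
        ≡⟨ ℤₚ.*-identityˡ _ ⟨
      1ℤ ℤ.* C k (rank q)
        ≡⟨ ℤₚ.+-identityˡ _ ⟨
      0ℤ ℤ.+ 1ℤ ℤ.* C k (rank q)
        ≡⟨ cong (ℤ._+ 1ℤ ℤ.* C k (rank q)) (∑-zero elements λ {p} _ → cong (ℤ._* term k p q)
             (⟦⟧-false (crosses? p q) λ (_ , _ , d≤) → ℤₚ.<⇒≱ (≤d-1⇒<d low) d≤)) ⟨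
      ∑ℤ elements (λ p → ⟦ crosses? p q ⟧ ℤ.* term k p q) ℤ.+ 1ℤ ℤ.* C k (rank q) ∎
    -- Here `d ≤ rank q`, and every `p` has rank at most `d`, so `g` counts every pair `p ≤ q`.
    ... | no ¬low = trans
      (∑-cong elements λ p → cong (ℤ._* term k p q) (⟦⟧-⇔ (p ≤? q) (crosses? p q)
        (λ p≤q → p≤q , bounded p , ≰d-1⇒d≤ ¬low) proj₁))
      (sym (ℤₚ.+-identityʳ _))

    𝓜-expansion : 𝓜 P rank ≈
      g P rank d + ∑ +-rawMonoid (ranksBelow d) (λ r → 1-z ^ ∣ r ℤ.+ 1ℤ ∣ * const (+ f P rank r))
    𝓜-expansion k = begin
      coeff (𝓜 P rank) k
        ≡⟨ ∑-pairs (λ (p , q) → p ≤? q) k ⟩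
      ∑ℤ elements (λ q → ∑ℤ elements (λ p → ⟦ p ≤? q ⟧ ℤ.* term k p q))
        ≡⟨ ∑-cong elements (column k) ⟩
      ∑ℤ elements (λ q → ∑ℤ elements (λ p → ⟦ crosses? p q ⟧ ℤ.* term k p q) ℤ.+ ⟦ low? q ⟧ ℤ.* C k (rank q))
        ≡⟨ ∑-+ elements _ _ ⟩
      ∑ℤ elements (λ q → ∑ℤ elements (λ p → ⟦ crosses? p q ⟧ ℤ.* term k p q)) ℤ.+
      ∑ℤ elements (λ q → ⟦ low? q ⟧ ℤ.* C k (rank q))
        ≡⟨ cong₂ ℤ._+_ (∑-pairs (λ (p , q) → crosses? p q) k) (∑-f (C k)) ⟨
      coeff (g P rank d) k ℤ.+ ∑ℤ (ranksBelow d) (λ r → C k r ℤ.* + f P rank r)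
        ≡⟨ cong (ℤ._+_ (coeff (g P rank d) k)) (∑-cong (ranksBelow d) λ r → coeff-*const (1-z ^ ∣ r ℤ.+ 1ℤ ∣) (+ f P rank r) k) ⟨
      coeff (g P rank d) k ℤ.+ ∑ℤ (ranksBelow d) (λ r → coeff (1-z ^ ∣ r ℤ.+ 1ℤ ∣ * const (+ f P rank r)) k)
        ≡⟨ cong (ℤ._+_ (coeff (g P rank d) k)) (coeff-∑ (ranksBelow d) _ k) ⟨
      coeff (g P rank d) k ℤ.+ coeff (∑ +-rawMonoid (ranksBelow d) (λ r → 1-z ^ ∣ r ℤ.+ 1ℤ ∣ * const (+ f P rank r))) k
        ≡⟨ coeff-+ (g P rank d) _ k ⟨
      coeff (g P rank d + ∑ +-rawMonoid (ranksBelow d) (λ r → 1-z ^ ∣ r ℤ.+ 1ℤ ∣ * const (+ f P rank r))) k ∎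

mainTheorem14 : ∀ {c ℓ₁ ℓ₂} (P : FinitePoset c ℓ₁ ℓ₂) (rank : FinitePoset.A P → ℤ) (d : ℤ) →
    IsNearSimplicial (FinitePoset.poset P) rank d →
    𝓜 P rank ≈ g P rank d + ∑ +-rawMonoid (ranksBelow d) (λ r →
    (1# + (- z)) ^ ∣ r ℤ.+ 1ℤ ∣ * const (+ f P rank r))
mainTheorem14 = 𝓜-expansion
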